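{- The parameterized problems \textsc{Tree Deletion Set}[vc] and \textsc{Tree Deletion Set}[tds] do not admit a boundaried kernelization (of any computable size $f$). More specifically, for a single-vertex boundary $B=\{x\}$, the relation $\equiv_{\textsc{TDS},B}$ has infinitely many equivalence classes both when restricted to $B$-boundaried graphs $G_B$ with $G-B$ edgeless and when restricted to $B$-boundaried graphs $G_B$ with $G-B$ a tree.
   Context: A boundaried graph $G_B$ is a finite simple graph $G$ together with a set $B\subseteq V(G)$ (the boundary). For boundaried graphs $G_B$ and $H_C$ with $V(G)\cap V(H)\subseteq B\cap C$, the gluing $G_B\oplus H_C$ is the simple graph obtained from the disjoint union of $G$ and $H$ by identifying each vertex of $B\cap C$ in $G$ with the identically named vertex in $H$ (an edge present in both is kept once). For an isomorphism-invariant optimization problem $\Pi$ on graphs with optimum value $\mathrm{OPT}_\Pi(G)$, two $B$-boundaried graphs $G_B,G'_B$ are gluing equivalent w.r.t. $\Pi$ and $B$, written $G_B\equiv_{\Pi,B}G'_B$, if there is $\Delta\in\mathbb{Z}$ with $\mathrm{OPT}_\Pi(G_B\oplus H_B)=\mathrm{OPT}_\Pi(G'_B\oplus H_B)+\Delta$ for every boundaried graph $H_B$. For a pure graph minimization problem $\rho$, a $\rho$-solution of $G$ is a feasible solution $s$ with value $\rho(G,s)$. For computable $f$, a boundaried kernelization of size $f$ for $\Pi[\rho]$ is a polynomial-time algorithm that, given a boundaried graph $G_B$ and a $\rho$-solution $s$ of $G$, outputs a boundaried graph $G'_B$ with $G_B\equiv_{\Pi,B}G'_B$, a $\rho$-solution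 $s'$ of $G'$ with $|G'|,|s'|,\rho(G',s')\le f(|B|+\rho(G,s))$ (encoding sizes), and an integer $\Delta$ with $\mathrm{OPT}_\Pi(G_B\oplus H_B)=\mathrm{OPT}_\Pi(G'_B\oplus H_B)+\Delta$ for all $H_B$. \textsc{Tree Deletion Set} (tds, TDS) is the minimization problem whose feasible solutions on $G$ are sets $S\subseteq V(G)$ such that $G-S$ is a tree, with value $|S|$. \textsc{Vertex Cover} (vc) is the minimization problem with feasible solutions $S\subseteq V(G)$ such that $G-S$ is edgeless, value $|S|$. $\Pi$[vc], $\Pi$[tds] denote $\rho=$ \textsc{Vertex Cover}, resp. $\rho=$ \textsc{Tree Deletion Set}. -}

module Defs where

open import Data.Bool.Base using (Bool; true; false)
open import Data.Fin.Base using (Fin; zero; suc)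
open import Data.Integer.Base as ℤ using (ℤ; +_; -[1+_])
open import Data.List.Base
  using (List; []; _∷_; [_]; _++_; _∷ʳ_; length; map; filter; concatMap; deduplicate)
open import Data.List.Membership.Propositional using (_∈_; _∉_)
open import Data.List.Membership.Propositional.Properties
  using (∈-++⁺ˡ; ∈-++⁺ʳ; ∈-filter⁺; ∈-deduplicate⁺)
open import Data.List.Relation.Unary.All using ([])
open import Data.List.Relation.Unary.Linked using (Linked)
open import Data.List.Relation.Unary.Unique.Propositional using (Unique; []; _∷_)
open import Data.List.Relation.Unary.Unique.Propositional.Properties using (filter⁺)
open import Data.Maybe.Base using (Maybe; just; nothing)
import Data.Maybe.Base as Maybe
open import Data.Nat.Base using (ℕ; zero; suc; _+_; _*_; _^_; _≤_)
open import Data.Nat.Properties using (_≟_)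
import Data.Nat.Binary.Base as ℕᵇ
open import Data.Product.Base using (Σ-syntax; ∃-syntax; _×_; _,_)
open import Data.Sum.Base as Sum using (_⊎_; inj₁; inj₂)
open import Function.Bundles using (_⇔_)
open import Level using (0ℓ)
open import Relation.Binary.Construct.Closure.ReflexiveTransitive using (Star)
open import Relation.Binary.Core using (Rel)
open import Relation.Binary.Definitions using (Decidable; Irreflexive; Symmetric)
open import Relation.Binary.PropositionalEquality using (_≡_; _≢_)
open import Relation.Nullary using (¬_; ¬?; does; _×-dec_; _⊎-dec_)
open import Relation.Unary using (Pred)
open import Data.List.Membership.DecPropositional _≟_ using (_∈?_)
open import Data.List.Relation.Unary.Unique.DecPropositional.Properties _≟_ using (deduplicate-!)

Vertex : Set
Vertex = ℕ

record VertexSet : Set where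
  field
    elements : List Vertex
    unique   : Unique elements

open VertexSet public

infix 4 _∈ₛ_ _∉ₛ_ _⊆ₛ_

_∈ₛ_ _∉ₛ_ : Vertex → VertexSet → Set
v ∈ₛ S = v ∈ elements S
v ∉ₛ S = v ∉ elements S

_⊆ₛ_ : VertexSet → VertexSet → Set
S ⊆ₛ T = ∀ {v} → v ∈ₛ S → v ∈ₛ T

∣_∣ₛ : VertexSet → ℕ
∣ S ∣ₛ = length (elements S)

⁅_⁆ : Vertex → VertexSet
⁅ x ⁆ = record { elements = [ x ] ; unique = [] ∷ [] }

_∪ₛ_ : VertexSet → VertexSet → VertexSet
S ∪ₛ T = record
  { elements = deduplicate _≟_ (elements S ++ elements T)
  ; unique   = deduplicate-! (elements S ++ elements T)
  }

record Graph : Set₁ where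
  infix 4 _~_ _~?_
  field
    V      : VertexSet
    _~_    : Rel Vertex 0ℓ
    _~?_   : Decidable _~_
    ~-sym  : Symmetric _~_
    ~-irr  : Irreflexive _≡_ _~_
    ~-left : ∀ {u v} → u ~ v → u ∈ₛ V

infixl 6 _∖_

_∖_ : Graph → VertexSet → Graph
G ∖ S = record
  { V      = record
      { elements = filter (λ v → ¬? (v ∈? elements S)) (elements V)
      ; unique   = filter⁺ (λ v → ¬? (v ∈? elements S)) (unique V)
      }
  ; _~_    = λ u v → u ~ v × u ∉ₛ S × v ∉ₛ S
  ; _~?_   = λ u v → (u ~? v) ×-dec (¬? (u ∈? elements S) ×-dec ¬? (v ∈? elements S))
  ; ~-sym  = λ (e , u∉ , v∉) → ~-sym e , v∉ , u∉
  ; ~-irr  = λ u≡v (e , _) → ~-irr u≡v e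
  ; ~-left = λ (e , u∉ , _) →
      ∈-filter⁺ (λ v → ¬? (v ∈? elements S)) (~-left e) u∉
  }
  where open Graph G

Edgeless : Graph → Set
Edgeless G = ∀ u v → ¬ (u ~ v)
  where open Graph G

-- The cycle x, y₁, …, yₘ, x with ys = y₁, …, yₘ has length m + 1 ≥ 3.
record IsCycle (G : Graph) (x : Vertex) (ys : List Vertex) : Set where
  open Graph G
  field
    distinct : Unique (x ∷ ys)
    long     : 2 ≤ length ys
    closed   : Linked _~_ (x ∷ (ys ∷ʳ x))

record IsTree (G : Graph) : Set where
  open Graph G
  field
    nonempty  : ∃[ v ] v ∈ₛ V
    connected : ∀ {u v} → u ∈ₛ V → v ∈ₛ V → Star _~_ u v
    acyclic   : ∀ x ys → ¬ IsCycle G x ys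

record Boundaried (B : VertexSet) : Set₁ where
  field
    graph      : Graph
    boundary⊆V : B ⊆ₛ Graph.V graph

open Boundaried public

Gluable : ∀ {B C} → Boundaried B → Boundaried C → Set
Gluable {B} {C} G H = ∀ {v} →
  v ∈ₛ Graph.V (graph G) → v ∈ₛ Graph.V (graph H) → v ∈ₛ B × v ∈ₛ C

infixl 6 _⊕_

-- For gluable G and H, vertices are identified exactly when they are boundary
-- vertices of the same name, so gluing is the union of the two graphs.  The
-- union is total; it is used only under the hypothesis Gluable G H.
_⊕_ : ∀ {B C} → Boundaried B → Boundaried C → Graph
Gb ⊕ Hc = record
  { V      = G.V ∪ₛ H.V
  ; _~_    = λ u v → u G.~ v ⊎ u H.~ v
  ; _~?_   = λ u v → (u G.~? v) ⊎-dec (u H.~? v)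
  ; ~-sym  = Sum.map G.~-sym H.~-sym
  ; ~-irr  = λ { u≡v (inj₁ e) → G.~-irr u≡v e
               ; u≡v (inj₂ e) → H.~-irr u≡v e }
  ; ~-left = λ { (inj₁ e) → ∈-deduplicate⁺ _≟_ (∈-++⁺ˡ (G.~-left e))
               ; (inj₂ e) → ∈-deduplicate⁺ _≟_ (∈-++⁺ʳ (elements G.V) (H.~-left e)) }
  }
  where
  module G = Graph (graph Gb)
  module H = Graph (graph Hc)

Bits : Set
Bits = List Bool

-- Every item is announced by a 1 and the list is closed by a 0, so the code is
-- self-delimiting whenever the codes of the items are.
listCode : {A : Set} → (A → Bits) → List A → Bits
listCode code []       = false ∷ []
listCode code (x ∷ xs) = true ∷ code x ++ listCode code xs

-- Bijective base 2, least significant digit first.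
digits : ℕᵇ.ℕᵇ → Bits
digits ℕᵇ.zero     = []
digits ℕᵇ.2[1+ n ] = true  ∷ digits n
digits ℕᵇ.1+[2 n ] = false ∷ digits n

ℕ-code : ℕ → Bits
ℕ-code n = listCode [_] (digits (ℕᵇ.fromℕ n))

ℤ-code : ℤ → Bits
ℤ-code (+ n)    = true  ∷ ℕ-code n
ℤ-code -[1+ n ] = false ∷ ℕ-code n

subsetCode : Graph → VertexSet → Bits
subsetCode G S = map (λ v → does (v ∈? elements S)) (elements (Graph.V G))

adjacencyCode : Graph → Bits
adjacencyCode G =
  concatMap (λ u → map (λ v → does (u ~? v)) (elements V)) (elements V)
  where open Graph G

graphCode : Graph → Bits
graphCode G = listCode ℕ-code (elements (Graph.V G)) ++ adjacencyCode G

boundariedCode : ∀ {B} → Boundaried B → Bits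
boundariedCode {B} G = graphCode (graph G) ++ subsetCode (graph G) B

-- Vertex names are part of every input and output but do not count towards the
-- size of a graph.  A boundaried graph that replaces G_B must keep the names of
-- B, and these are arbitrarily long: if they counted, no function of |B| + ρ
-- could bound the size of an output, for any problem at all.
∣_∣ᴳ : Graph → ℕ
∣ G ∣ᴳ = length (adjacencyCode G)

record MinimizationProblem : Set₁ where
  field
    Solution : Set
    Feasible : Graph → Solution → Set
    value    : Graph → Solution → ℕ
    code     : Graph → Solution → Bits

TDS : MinimizationProblem
TDS = record
  { Solution = VertexSet
  ; Feasible = λ G S → S ⊆ₛ Graph.V G × IsTree (G ∖ S)
  ; value    = λ _ S → ∣ S ∣ₛ
  ; code     = subsetCode
  }

VC : MinimizationProblem
VC = record
  { Solution = VertexSet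
  ; Feasible = λ G S → S ⊆ₛ Graph.V G × Edgeless (G ∖ S)
  ; value    = λ _ S → ∣ S ∣ₛ
  ; code     = subsetCode
  }

-- OPT_Π(G) = z; there is no such z if G has no feasible solution.
IsOPT : MinimizationProblem → Graph → ℤ → Set
IsOPT Π G z =
  (Σ[ s ∈ Solution ] Feasible G s × + value G s ≡ z) ×
  (∀ s → Feasible G s → z ℤ.≤ + value G s)
  where open MinimizationProblem Π

-- OPT_Π(G_B ⊕ H_B) = OPT_Π(G'_B ⊕ H_B) + Δ for every H_B, where an infeasible
-- side means that both are infeasible.  For isomorphism-invariant Π nothing is
-- lost by considering only those H_B whose non-boundary vertices are named
-- apart from G and G'.
EquivalentWithShift : MinimizationProblem → ∀ {B} → Boundaried B → Boundaried B → ℤ → Set₁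
EquivalentWithShift Π {B} G G′ Δ =
  ∀ (H : Boundaried B) → Gluable G H → Gluable G′ H →
  ∀ z → IsOPT Π (G ⊕ H) (z ℤ.+ Δ) ⇔ IsOPT Π (G′ ⊕ H) z

GluingEquivalent : MinimizationProblem → (B : VertexSet) → Boundaried B → Boundaried B → Set₁
GluingEquivalent Π B G G′ = ∃[ Δ ] EquivalentWithShift Π G G′ Δ

-- Infinitely many classes of R meet P: there is an infinite sequence of
-- pairwise inequivalent elements of P.
InfinitelyManyClasses : ∀ {a ℓ p} {A : Set a} → Rel A ℓ → Pred A p → Set _
InfinitelyManyClasses {A = A} R P =
  Σ[ x ∈ (ℕ → A) ] (∀ i → P (x i)) × (∀ i j → i ≢ j → ¬ R (x i) (x j))

data Direction : Set where
  left right stay : Direction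

-- A deterministic machine with one tape, infinite in both directions.  Among
-- the tape symbols, 0 is the blank, 1 and 2 stand for the bits false and true.
-- The machine starts in state 0 and halts where δ is undefined.
record TM : Set where
  field
    extraSymbols : ℕ
    extraStates  : ℕ
    δ : Fin (suc extraStates) → Fin (3 + extraSymbols) →
        Maybe (Fin (suc extraStates) × Fin (3 + extraSymbols) × Direction)

module _ (M : TM) where
  open TM M

  Symbol State : Set
  Symbol = Fin (3 + extraSymbols)
  State  = Fin (suc extraStates)

  -- The tape to the left of the head is listed from the head outwards; all
  -- cells beyond the two lists are blank.
  record Config : Set where
    constructor config
    field
      state       : State
      tapeToLeft  : List Symbol
      scanned     : Symbol
      tapeToRight : List Symbol

  move : Direction → State → List Symbol → Symbol → List Symbol → Config
  move stay  q ls       a rs       = config q ls a rs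
  move left  q []       a rs       = config q [] zero (a ∷ rs)
  move left  q (l ∷ ls) a rs       = config q ls l (a ∷ rs)
  move right q ls       a []       = config q (a ∷ ls) zero []
  move right q ls       a (r ∷ rs) = config q (a ∷ ls) r rs

  step : Config → Maybe Config
  step (config q ls a rs) =
    Maybe.map (λ (q′ , b , d) → move d q′ ls b rs) (δ q a)

  bitSymbol : Bool → Symbol
  bitSymbol false = suc zero
  bitSymbol true  = suc (suc zero)

  initial : Bits → Config
  initial []       = config zero [] zero []
  initial (b ∷ bs) = config zero [] (bitSymbol b) (map bitSymbol bs)

  leadingBits : List Symbol → Bits
  leadingBits (suc zero       ∷ as) = false ∷ leadingBits as
  leadingBits (suc (suc zero) ∷ as) = true  ∷ leadingBits as
  leadingBits _                     = []

  -- The longest word of bits starting at the head.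
  output : Config → Bits
  output (config _ _ a rs) = leadingBits (a ∷ rs)

  -- The output, provided the machine halts after at most t steps.
  runFor : ℕ → Config → Maybe Bits
  runFor t c with step c
  runFor _       c | nothing = just (output c)
  runFor zero    c | just _  = nothing
  runFor (suc t) c | just c′ = runFor t c′

  OutputsWithin : ℕ → Bits → Bits → Set
  OutputsWithin t input out = runFor t (initial input) ≡ just out

Computable : (ℕ → ℕ) → Set
Computable f = Σ[ M ∈ TM ] ∀ n → ∃[ t ] OutputsWithin M t (ℕ-code n) (ℕ-code (f n))

record Input (ρ : MinimizationProblem) : Set₁ where
  open MinimizationProblem ρ
  field
    B        : VertexSet
    G        : Boundaried B
    s        : Solution
    feasible : Feasible (graph G) s

record Output (ρ : MinimizationProblem) (B : VertexSet) : Set₁ where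
  open MinimizationProblem ρ
  field
    G        : Boundaried B
    s        : Solution
    feasible : Feasible (graph G) s
    Δ        : ℤ

inputCode : ∀ {ρ} → Input ρ → Bits
inputCode {ρ} I = boundariedCode G ++ code (graph G) s
  where
  open MinimizationProblem ρ
  open Input I

outputCode : ∀ {ρ B} → Output ρ B → Bits
outputCode {ρ} O = boundariedCode G ++ code (graph G) s ++ ℤ-code Δ
  where
  open MinimizationProblem ρ
  open Output O

record IsKernel (f : ℕ → ℕ) (Π : MinimizationProblem) {ρ : MinimizationProblem}
                (I : Input ρ) (O : Output ρ (Input.B I)) : Set₁ where
  open MinimizationProblem ρ
  open Input I
  open Output O renaming (G to G′; s to s′) using (Δ)

  bound : ℕ
  bound = f (∣ B ∣ₛ + value (graph G) s)

  field
    equivalent    : EquivalentWithShift Π G G′ Δ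
    graphSize     : ∣ graph G′ ∣ᴳ ≤ bound
    solutionSize  : length (code (graph G′) s′) ≤ bound
    solutionValue : value (graph G′) s′ ≤ bound

record BoundariedKernelization (f : ℕ → ℕ) (Π ρ : MinimizationProblem) : Set₁ where
  field
    machine : TM
    c d     : ℕ

  time : ℕ → ℕ
  time n = c * n ^ d + c

  field
    correct : (I : Input ρ) → Σ[ O ∈ Output ρ (Input.B I) ]
      OutputsWithin machine (time (length (inputCode I))) (inputCode I) (outputCode O) ×
      IsKernel f Π I O

{-# OPTIONS --safe #-}
-- Glue a graph on the boundary x in two ways: to x alone, and to a large fan
-- (x joined to all vertices of a path) whose vertex names are fresh.  For the
-- star with centre x and n leaves the first optimum is 0, and the second is at
-- least n + 1: keeping x means destroying many triangles that pairwise share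
-- only x, and deleting x isolates all leaves.  For a graph G′ the first optimum
-- is at least 0 and the second at most |V(G′)|, since deleting all of G′ leaves
-- a path.  Hence whatever is equivalent to the n-leaf star has at least n
-- vertices.  Exchanging the roles of stars and fans gives the same for fans
-- (whose optimum when glued to x alone is 1).  So representatives have unbounded
-- size, although all stars and fans have the solution {x} of size 1.
module Submission where

open import Defs
open import Data.Empty using (⊥)
open import Data.Integer.Base as ℤ using (ℤ; +_)
import Data.Integer.Properties as ℤₚ
open import Data.List.Base
  using (List; []; _∷_; _++_; _∷ʳ_; length; map; concatMap; applyUpTo)
open import Data.List.Extrema.Nat using (max; xs≤max)
open import Data.List.Membership.Propositional using (_∈_; _∉_; find)
open import Data.List.Membership.Propositional.Properties
  using (∈-∃++; ∈-++⁺ˡ; ∈-++⁺ʳ; ∈-++⁻; ∈-filter⁺; ∈-filter⁻; ∈-deduplicate⁺; ∈-deduplicate⁻;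
         ∈-applyUpTo⁺; ∈-applyUpTo⁻)
open import Data.List.Properties
  using (length-++; length-map; length-applyUpTo; length-filter)
open import Data.List.Relation.Unary.All as All using (All; []; _∷_)
open import Data.List.Relation.Unary.All.Properties using (¬All⇒Any¬; ++⁻ˡ; ++⁻ʳ)
open import Data.List.Relation.Unary.AllPairs using ([]; _∷_)
open import Data.List.Relation.Unary.Any using (here; there)
open import Data.List.Relation.Unary.Linked as Linked using (Linked; [-]; _∷_)
open import Data.List.Relation.Unary.Unique.Propositional using (Unique)
import Data.List.Relation.Unary.Unique.Propositional.Properties as Unique
open import Data.Nat.Base using (ℕ; zero; suc; _+_; _*_; _≤_; _<_; _⊔_; z≤n; s≤s)
open import Data.Nat.Induction using (<-wellFounded; <-rec)
open import Data.Nat.Properties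
open import Data.List.Membership.DecPropositional _≟_ using (_∈?_)
open import Data.Product.Base using (∃-syntax; _×_; _,_; proj₁; proj₂)
open import Data.Sum.Base as Sum using (_⊎_; inj₁; inj₂)
open import Function.Base using (_∘_)
open import Function.Bundles using (mk⇔; module Equivalence)
open import Induction.WellFounded using (Acc; acc)
open import Level using (0ℓ)
open import Relation.Binary.Construct.Closure.ReflexiveTransitive using (Star; ε; _◅_; _◅◅_)
import Relation.Binary.Construct.Closure.ReflexiveTransitive as Star
open import Relation.Binary.Core using (Rel)
open import Relation.Binary.Definitions using (Decidable; Symmetric; Irreflexive; tri<; tri≈; tri>)
open import Relation.Binary.PropositionalEquality
  using (_≡_; _≢_; refl; sym; trans; cong; cong₂; subst)
open import Relation.Nullary
  using (¬_; yes; no; ¬?; contradiction; decidable-stable; _×-dec_; _⊎-dec_)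

-- Lists

-- The pigeonhole principle. Every lower bound on a deletion set is obtained by exhibiting distinct
-- vertices in it.
Unique⇒length-≤ : {xs ys : List ℕ} → Unique xs → (∀ {v} → v ∈ xs → v ∈ ys) → length xs ≤ length ys
Unique⇒length-≤ {[]} _ _ = z≤n
Unique⇒length-≤ {x ∷ xs} (x∉xs ∷ xs!) xs⊆ys with ∈-∃++ (xs⊆ys (here refl))
... | ps , qs , refl = begin
  suc (length xs)               ≤⟨ s≤s (Unique⇒length-≤ xs! without-x) ⟩
  suc (length (ps ++ qs))       ≡⟨ cong suc (length-++ ps) ⟩
  suc (length ps + length qs)   ≡⟨ +-suc (length ps) (length qs) ⟨
  length ps + suc (length qs)   ≡⟨ length-++ ps ⟨
  length (ps ++ x ∷ qs)         ∎
  where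
  open ≤-Reasoning
  without-x : ∀ {v} → v ∈ xs → v ∈ ps ++ qs
  without-x v∈xs with ∈-++⁻ ps (xs⊆ys (there v∈xs))
  ... | inj₁ v∈ps         = ∈-++⁺ˡ v∈ps
  ... | inj₂ (here refl)  = contradiction refl (All.lookup x∉xs v∈xs)
  ... | inj₂ (there v∈qs) = ∈-++⁺ʳ ps v∈qs

-- Applied to `adjacencyCode`, this shows that the size of a graph is the square of its number of
-- vertices, so a size bound is also a bound on the vertex count.
length-concatMap-map : {A B C : Set} (g : A → B → C) (xs : List A) (ys : List B) →
  length (concatMap (λ x → map (g x) ys) xs) ≡ length xs * length ys
length-concatMap-map g []       ys = refl
length-concatMap-map g (x ∷ xs) ys =
  trans (length-++ (map (g x) ys))
        (cong₂ _+_ (length-map (g x) ys) (length-concatMap-map g xs ys))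

-- New vertex names form an interval, so they avoid a given graph as soon as `a` exceeds all of its
-- names.
range : ℕ → ℕ → List ℕ
range a n = applyUpTo (λ i → a + i) n

∈-range⁺ : ∀ {a n v} → a ≤ v → v < a + n → v ∈ range a n
∈-range⁺ {a} {n} {v} a≤v v<a+n =
  subst (_∈ range a n) (m+[n∸m]≡n a≤v)
    (∈-applyUpTo⁺ (λ i → a + i)
      (+-cancelˡ-< a _ n (subst (_< a + n) (sym (m+[n∸m]≡n a≤v)) v<a+n)))

∈-range⁻ : ∀ {a n v} → v ∈ range a n → a ≤ v × v < a + n
∈-range⁻ {a} {n} v∈ with ∈-applyUpTo⁻ (λ i → a + i) v∈
... | i , i<n , refl = m≤m+n a i , +-monoʳ-< a i<n

range-! : ∀ a n → Unique (range a n)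
range-! a n = Unique.applyUpTo⁺₁ (λ i → a + i) n λ i<j _ eq → <⇒≢ i<j (+-cancelˡ-≡ a _ _ eq)

∷-range-! : ∀ {x a} n → x < a → Unique (x ∷ range a n)
∷-range-! {x} {a} n x<a =
  All.tabulate (λ v∈ → <⇒≢ (<-≤-trans x<a (proj₁ (∈-range⁻ {a} {n} v∈)))) ∷ range-! a n

-- Trees

module _ (G : Graph) where
  open Graph G

  module _ (unique-below : ∀ {u v w} → u ~ v → u ~ w → v < u → w < u → v ≡ w) where

    -- A walk that has once ascended cannot turn down: both neighbours of the
    -- turning point would lie below it.
    ascends-on : ∀ {a b zs} → Linked _~_ (a ∷ b ∷ zs) → Unique (a ∷ b ∷ zs) → a < b →
      All (a <_) (b ∷ zs)
    ascends-on {zs = []} _ _ a<b = a<b ∷ []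
    ascends-on {b = b} {zs = c ∷ zs} (a~b ∷ b~c ∷ walk) ((_ ∷ a≢c ∷ _) ∷ uniq) a<b
      with <-cmp b c
    ... | tri< b<c _ _ = a<b ∷ All.map (<-trans a<b) (ascends-on (b~c ∷ walk) uniq b<c)
    ... | tri≈ _ b≡c _ = contradiction b~c (~-irr b≡c)
    ... | tri> _ _ c<b = contradiction (unique-below (~-sym a~b) b~c a<b c<b) a≢c

    -- A walk without an interior peak first descends and then ascends. If its last step into `z`
    -- does not ascend, then all steps descend and `z` lies below the start.
    descends-or-ends-ascending : ∀ a b zs {z} →
      Linked _~_ (a ∷ b ∷ (zs ∷ʳ z)) → Unique (a ∷ b ∷ (zs ∷ʳ z)) →
      z < a ⊎ (∃[ w ] w ∈ b ∷ zs × w ~ z × w < z)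
    descends-or-ends-ascending a b [] {z} (a~b ∷ b~z ∷ _) ((_ ∷ a≢z ∷ _) ∷ _)
      with <-cmp b z
    ... | tri< b<z _ _ = inj₂ (b , here refl , b~z , b<z)
    ... | tri≈ _ b≡z _ = contradiction b~z (~-irr b≡z)
    ... | tri> _ _ z<b with <-cmp a b
    ...   | tri< a<b _ _ = contradiction (unique-below (~-sym a~b) b~z a<b z<b) a≢z
    ...   | tri≈ _ a≡b _ = contradiction a~b (~-irr a≡b)
    ...   | tri> _ _ b<a = inj₁ (<-trans z<b b<a)
    descends-or-ends-ascending a b (c ∷ zs) {z} walk@(a~b ∷ walk′) uniq@(_ ∷ uniq′)
      with descends-or-ends-ascending b c zs walk′ uniq′
    ... | inj₂ (w , w∈ , w~z , w<z) = inj₂ (w , there w∈ , w~z , w<z)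
    ... | inj₁ z<b with <-cmp a b
    ...   | tri≈ _ a≡b _ = contradiction a~b (~-irr a≡b)
    ...   | tri> _ _ b<a = inj₁ (<-trans z<b b<a)
    ...   | tri< a<b _ _ with walk′ | uniq
    ...     | b~c ∷ _ | (_ ∷ a≢c ∷ _) ∷ _ with <-cmp b c
    ...       | tri> _ _ c<b = contradiction (unique-below (~-sym a~b) b~c a<b c<b) a≢c
    ...       | tri≈ _ b≡c _ = contradiction b~c (~-irr b≡c)
    -- Having risen from `b` to `c`, the walk stays above `b` up to its end `z`, against `z<b`.
    ...       | tri< b<c _ _ =
                contradiction (All.lookup (ascends-on walk′ uniq′ b<c) (∈-++⁺ʳ (c ∷ zs) (here refl)))
                              (<-asym z<b)

    -- A cycle has a vertex above both of its neighbours on the cycle, which `unique-below` forbids.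
    -- Instead of locating a maximum, the proof cuts the cycle open and follows it from `y` round to
    -- `x`.
    unique-below⇒acyclic : ∀ x ys → ¬ IsCycle G x ys
    unique-below⇒acyclic x [] cyc with () ← IsCycle.long cyc
    unique-below⇒acyclic x (_ ∷ []) cyc with s≤s () ← IsCycle.long cyc
    unique-below⇒acyclic x (y ∷ y′ ∷ ys)
      record { distinct = x∉ys@(x≢y ∷ x≢y′ ∷ _) ∷ ys!@(y∉ys ∷ _)
             ; closed = x~y ∷ walk@(y~y′ ∷ _) }
      with <-cmp x y
    ... | tri≈ _ x≡y _ = x≢y x≡y
    -- Either the walk descends all the way, which puts `x` below `y`, or it enters `x` from below
    -- and `x` has a second smaller neighbour besides `y`.
    ... | tri> _ _ y<x with descends-or-ends-ascending y y′ ys walk rotated!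
      where
      rotated! : Unique (y ∷ y′ ∷ (ys ∷ʳ x))
      rotated! = Unique.++⁺ ys! ([] ∷ []) λ { (v∈ , here refl) → All.lookup x∉ys v∈ refl }
    ...   | inj₁ x<y = <-asym x<y y<x
    ...   | inj₂ (w , w∈ , w~x , w<x) =
            All.lookup y∉ys w∈ (unique-below x~y (~-sym w~x) y<x w<x)
    unique-below⇒acyclic x (y ∷ y′ ∷ ys)
      record { distinct = x∉ys@(x≢y ∷ x≢y′ ∷ _) ∷ ys!@(y∉ys ∷ _)
             ; closed = x~y ∷ walk@(y~y′ ∷ _) }
      | tri< x<y _ _ with <-cmp y y′
    ...   | tri≈ _ y≡y′ _ = ~-irr y≡y′ y~y′
    ...   | tri> _ _ y′<y = x≢y′ (unique-below (~-sym x~y) y~y′ x<y y′<y)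
    -- The walk rises from `y` and so stays above it, yet it ends at `x`, which lies below `y`.
    ...   | tri< y<y′ _ _ =
            <-asym x<y (All.lookup (ascends-on walk rotated! y<y′) (∈-++⁺ʳ (y′ ∷ ys) (here refl)))
      where
      rotated! : Unique (y ∷ y′ ∷ (ys ∷ʳ x))
      rotated! = Unique.++⁺ ys! ([] ∷ []) λ { (v∈ , here refl) → All.lookup x∉ys v∈ refl }

    -- Smaller neighbours act as parents: following them ends at the root `r` by well-founded
    -- induction, and their uniqueness excludes cycles.
    unique-below⇒IsTree : ∀ r → r ∈ₛ V → (∀ v → v ∈ₛ V → v ≡ r ⊎ (∃[ w ] v ~ w × w < v)) → IsTree G
    unique-below⇒IsTree r r∈V below = record
      { nonempty  = r , r∈V
      ; connected = λ u∈V v∈V → to-root _ u∈V ◅◅ Star.reverse ~-sym (to-root _ v∈V)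
      ; acyclic   = unique-below⇒acyclic
      }
      where
      to-root : ∀ v → v ∈ₛ V → Star _~_ v r
      to-root = <-rec _ λ v rec v∈V → case-below v rec (below v v∈V)
        where
        case-below : ∀ v → (∀ {w} → w < v → w ∈ₛ V → Star _~_ w r) →
          v ≡ r ⊎ (∃[ w ] v ~ w × w < v) → Star _~_ v r
        case-below v rec (inj₁ refl)             = ε
        case-below v rec (inj₂ (w , v~w , w<v)) = v~w ◅ rec w<v (~-left (~-sym v~w))

-- Membership in differences and unions of vertex sets

∈-∖⁺ : ∀ (G : Graph) S {v} → v ∈ₛ Graph.V G → v ∉ₛ S → v ∈ₛ Graph.V (G ∖ S)
∈-∖⁺ G S = ∈-filter⁺ (λ v → ¬? (v ∈? elements S))

∈-∖⁻ : ∀ (G : Graph) S {v} → v ∈ₛ Graph.V (G ∖ S) → v ∈ₛ Graph.V G × v ∉ₛ S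
∈-∖⁻ G S = ∈-filter⁻ (λ v → ¬? (v ∈? elements S))

∈-∪⁻ : ∀ S T {v} → v ∈ₛ S ∪ₛ T → v ∈ₛ S ⊎ v ∈ₛ T
∈-∪⁻ S T v∈ = ∈-++⁻ (elements S) (∈-deduplicate⁻ _≟_ _ v∈)

∈-∪⁺ˡ : ∀ S T {v} → v ∈ₛ S → v ∈ₛ S ∪ₛ T
∈-∪⁺ˡ S T v∈ = ∈-deduplicate⁺ _≟_ (∈-++⁺ˡ v∈)

∈-∪⁺ʳ : ∀ S T {v} → v ∈ₛ T → v ∈ₛ S ∪ₛ T
∈-∪⁺ʳ S T v∈ = ∈-deduplicate⁺ _≟_ (∈-++⁺ʳ (elements S) v∈)

∅ₛ : VertexSet
∅ₛ = record { elements = [] ; unique = [] }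

-- Gluing equivalence

z-i+i≡z : ∀ z i → z ℤ.- i ℤ.+ i ≡ z
z-i+i≡z z i = trans (ℤₚ.+-assoc z (ℤ.- i) i)
  (trans (cong (λ j → z ℤ.+ j) (ℤₚ.+-inverseˡ i)) (ℤₚ.+-identityʳ z))

module _ (Π : MinimizationProblem) where
  open MinimizationProblem Π

  -- Which solution is optimal is not computable from Feasible alone.
  ¬¬-IsOPT : ∀ G s → Feasible G s → ¬ ¬ (∃[ z ] IsOPT Π G z)
  ¬¬-IsOPT G s fs no-opt = go s (<-wellFounded (value G s)) fs
    where
    go : ∀ s → Acc _<_ (value G s) → Feasible G s → ⊥
    go s (acc rec) fs = no-opt (+ value G s , (s , fs , refl) , λ t ft →
      ℤ.+≤+ (≮⇒≥ λ t<s → go t (rec t<s) ft))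

  module _ {B : VertexSet} {G G′ : Boundaried B} {Δ : ℤ} (G≡G′ : EquivalentWithShift Π G G′ Δ) where

    EquivalentWithShift-sym : EquivalentWithShift Π G′ G (ℤ.- Δ)
    EquivalentWithShift-sym H gl′ gl z = mk⇔
      (λ opt → subst (IsOPT Π (G ⊕ H)) (z-i+i≡z _ Δ) (Equivalence.from E opt))
      (λ opt → Equivalence.to E (subst (IsOPT Π (G ⊕ H)) (sym (z-i+i≡z _ Δ)) opt))
      where
      E = G≡G′ H gl gl′ (z ℤ.- Δ)

    -- A feasible solution is required on one side only: the equivalence carries the optimum over to
    -- `G′ ⊕ H`.
    ¬¬-shifted-IsOPT : ∀ H → Gluable G H → Gluable G′ H → ∀ s → Feasible (G ⊕ H) s →
      ¬ ¬ (∃[ z ] IsOPT Π (G ⊕ H) (z ℤ.+ Δ) × IsOPT Π (G′ ⊕ H) z)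
    ¬¬-shifted-IsOPT H gl gl′ s fs none = ¬¬-IsOPT (G ⊕ H) s fs λ (z , opt) →
      let opt′ = subst (IsOPT Π (G ⊕ H)) (sym (z-i+i≡z _ Δ)) opt
      in none (z ℤ.- Δ , opt′ , Equivalence.to (G≡G′ H gl gl′ _) opt′)

    -- The test graph `H₀` bounds the shift: values are nonnegative, so Δ is at most the optimum of
    -- `G ⊕ H₀`, hence at most the value of `s₀`. With the test graph `H`, k is at most the optimum
    -- of `G ⊕ H`, which is the optimum of `G′ ⊕ H` plus Δ; the former is at most the value of `s′`.
    equivalent⇒lower-bound :
      ∀ H₀ → Gluable G H₀ → Gluable G′ H₀ → ∀ s₀ → Feasible (G ⊕ H₀) s₀ →
      ∀ H → Gluable G H → Gluable G′ H → ∀ s → Feasible (G ⊕ H) s →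
      ∀ {k} → (∀ t → Feasible (G ⊕ H) t → k ≤ value (G ⊕ H) t) →
      ∀ s′ → Feasible (G′ ⊕ H) s′ →
      k ≤ value (G′ ⊕ H) s′ + value (G ⊕ H₀) s₀
    equivalent⇒lower-bound H₀ gl₀ gl₀′ s₀ fs₀ H gl gl′ s fs {k} k≤ s′ fs′ =
      -- The goal is decidable, hence stable under double negation, so both pairs of optima may be
      -- assumed to exist.
      decidable-stable (k ≤? _) λ ¬bound →
      ¬¬-shifted-IsOPT H₀ gl₀ gl₀′ s₀ fs₀ λ
        { (_ , (_ , ≤s₀) , ((t₀ , _ , refl) , _)) →
      ¬¬-shifted-IsOPT H gl gl′ s fs λ
        { (z , ((t , ft , t≡) , _) , (_ , ≤s′)) →
      ¬bound (ℤₚ.drop‿+≤+ (begin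
        + k                                       ≤⟨ ℤ.+≤+ (k≤ t ft) ⟩
        + value (G ⊕ H) t                         ≡⟨ t≡ ⟩
        z ℤ.+ Δ                                   ≤⟨ ℤₚ.+-mono-≤ (≤s′ s′ fs′) (Δ≤ t₀ (≤s₀ s₀ fs₀)) ⟩
        + (value (G′ ⊕ H) s′ + value (G ⊕ H₀) s₀) ∎)) } }
      where
      open ℤₚ.≤-Reasoning
      Δ≤ : ∀ t₀ → + value (G′ ⊕ H₀) t₀ ℤ.+ Δ ℤ.≤ + value (G ⊕ H₀) s₀ → Δ ℤ.≤ + value (G ⊕ H₀) s₀
      Δ≤ t₀ ≤s₀ = ℤₚ.≤-trans (ℤₚ.i≤j⇒i≤k+j (+ value (G′ ⊕ H₀) t₀) ℤₚ.≤-refl) ≤s₀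

-- Families all of whose equivalent representatives grow

Incompressible : MinimizationProblem → (B : VertexSet) → (ℕ → Boundaried B) → Set₁
Incompressible Π B G =
  ∀ n G′ → GluingEquivalent Π B (G n) G′ → n ≤ ∣ Graph.V (graph G′) ∣ₛ

module _ (Π : MinimizationProblem) {B : VertexSet} (G : ℕ → Boundaried B) (incompressible : Incompressible Π B G) where

  -- Some members of the family may be equivalent to each other, so a subsequence is taken in which
  -- every index exceeds the sizes of all graphs chosen before. An earlier graph is then too small
  -- to represent the class of a later one.
  incompressible⇒infinitely-many : ∀ {p} (P : Boundaried B → Set p) → (∀ n → P (G n)) →
    InfinitelyManyClasses (GluingEquivalent Π B) P
  incompressible⇒infinitely-many P PG = G ∘ index , PG ∘ index , inequivalent
    where
    size : ℕ → ℕ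
    size n = ∣ Graph.V (graph (G n)) ∣ₛ

    -- Taking the maximum with `index i` makes the sequence increase, so that each index also
    -- exceeds the sizes of graphs chosen more than one step earlier.
    index : ℕ → ℕ
    index zero    = 0
    index (suc i) = suc (index i ⊔ size (index i))

    size<index : ∀ {j} i → j < i → size (index j) < index i
    size<index {j} (suc i) (s≤s j≤i) with m≤n⇒m<n∨m≡n j≤i
    ... | inj₁ j<i  = <-trans (size<index i j<i) (s≤s (m≤m⊔n _ _))
    ... | inj₂ refl = s≤s (m≤n⊔m (index i) _)

    inequivalent : ∀ i j → i ≢ j → ¬ GluingEquivalent Π B (G (index i)) (G (index j))
    inequivalent i j i≢j i≡j@(Δ , E) with <-cmp i j
    ... | tri≈ _ i=j _ = i≢j i=j
    ... | tri> _ _ j<i = <⇒≱ (size<index i j<i) (incompressible (index i) _ i≡j)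
    ... | tri< i<j _ _ = <⇒≱ (size<index j i<j)
            (incompressible (index j) _ (_ , EquivalentWithShift-sym Π E))

  module _ (ρ : MinimizationProblem) where
    open MinimizationProblem ρ

    -- The parameter is the same for the whole family, so all kernels obey one common size bound,
    -- while the representatives grow with `n`.
    incompressible⇒no-kernelization :
      (s : ℕ → Solution) → (∀ n → Feasible (graph (G n)) (s n)) →
      ∀ {c} → (∀ n → value (graph (G n)) (s n) ≡ c) →
      ∀ f → ¬ BoundariedKernelization f Π ρ
    incompressible⇒no-kernelization s feasible {c} value≡c f K
      with BoundariedKernelization.correct K
             (record { B = B ; G = G n ; s = s n ; feasible = feasible n })
      -- One more than the size bound that holds for every kernel of the family.
      where n = suc (f (∣ B ∣ₛ + c))
    ... | O , _ , kernel = <⇒≱ (≤-<-trans small (n<1+n _))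
            (incompressible _ _ (_ , IsKernel.equivalent kernel))
      where
      G′ = graph (Output.G O)
      V′ = Graph.V G′
      open ≤-Reasoning
      small : ∣ V′ ∣ₛ ≤ f (∣ B ∣ₛ + c)
      small = begin
        ∣ V′ ∣ₛ              ≤⟨ n≤n*n ∣ V′ ∣ₛ ⟩
        ∣ V′ ∣ₛ * ∣ V′ ∣ₛ    ≡⟨ length-concatMap-map _ (elements V′) (elements V′) ⟨
        ∣ G′ ∣ᴳ              ≤⟨ IsKernel.graphSize kernel ⟩
        f (∣ B ∣ₛ + _)       ≡⟨ cong (λ v → f (∣ B ∣ₛ + v)) (value≡c _) ⟩
        f (∣ B ∣ₛ + c)       ∎
        where
        n≤n*n : ∀ n → n ≤ n * n
        n≤n*n zero    = z≤n
        n≤n*n (suc n) = m≤m*n (suc n) (suc n)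

-- Stars and fans

-- The start `a` of the interval is left free, so that the same shape serves both as a member of a
-- family and as a test graph on fresh names.
cone : ∀ x {a} → x < a → ℕ → (R : Rel Vertex 0ℓ) → Decidable R → Symmetric R → Irreflexive _≡_ R →
  Boundaried ⁅ x ⁆
cone x {a} x<a n R R? R-sym R-irr = record
  { graph = record
    { V      = record { elements = x ∷ range a n ; unique = ∷-range-! n x<a }
    ; _~_    = λ u v → (u ≡ x × v ∈ range a n) ⊎ (v ≡ x × u ∈ range a n)
                       ⊎ (u ∈ range a n × v ∈ range a n × R u v)
    ; _~?_   = λ u v → ((u ≟ x) ×-dec (v ∈? range a n)) ⊎-dec ((v ≟ x) ×-dec (u ∈? range a n))
                       ⊎-dec ((u ∈? range a n) ×-dec (v ∈? range a n) ×-dec R? u v)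
    ; ~-sym  = λ { (inj₁ e) → inj₂ (inj₁ e) ; (inj₂ (inj₁ e)) → inj₁ e
                 ; (inj₂ (inj₂ (u∈ , v∈ , r))) → inj₂ (inj₂ (v∈ , u∈ , R-sym r)) }
    ; ~-irr  = λ { refl (inj₁ (refl , x∈)) → x∉range x∈
                 ; refl (inj₂ (inj₁ (refl , x∈))) → x∉range x∈
                 ; u≡v (inj₂ (inj₂ (_ , _ , r))) → R-irr u≡v r }
    ; ~-left = λ { (inj₁ (refl , _)) → here refl ; (inj₂ (inj₁ (_ , u∈))) → there u∈
                 ; (inj₂ (inj₂ (u∈ , _))) → there u∈ }
    }
  ; boundary⊆V = λ { (here refl) → here refl }
  }
  where
  x∉range : x ∉ range a n
  x∉range x∈ = <⇒≱ x<a (proj₁ (∈-range⁻ {a} {n} x∈))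

Consecutive : Rel Vertex 0ℓ
Consecutive u v = suc u ≡ v ⊎ suc v ≡ u

-- A path on `m * 2` vertices contains `m` disjoint edges, each of which forms a triangle with `x`.
star fan : ∀ x {a} → x < a → ℕ → Boundaried ⁅ x ⁆
star x x<a n = cone x x<a n (λ _ _ → ⊥) (λ _ _ → no λ ()) (λ ()) (λ _ ())
fan x x<a m = cone x x<a (m * 2) Consecutive
  (λ u v → (suc u ≟ v) ⊎-dec (suc v ≟ u)) Sum.swap
  (λ { refl (inj₁ eq) → 1+n≢n eq ; refl (inj₂ eq) → 1+n≢n eq })

-- If S avoids x, it hits m triangles that pairwise share only x.  If S contains
-- x, the leaves become isolated, so S contains all leaves or the whole path.
module TriangleBound (K : Graph) (x : Vertex)
  {a n b m : ℕ} (x<a : x < a) (x<b : x < b)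
  (disjoint : ∀ {v} → v ∈ range a n → v ∉ range b (m * 2))
  (leaf∈V   : ∀ {v} → v ∈ range a n → v ∈ₛ Graph.V K)
  (leaf~    : ∀ {v w} → v ∈ range a n → Graph._~_ K v w → w ≡ x)
  (path∈V   : ∀ {v} → v ∈ range b (m * 2) → v ∈ₛ Graph.V K)
  (spoke    : ∀ {v} → v ∈ range b (m * 2) → Graph._~_ K x v)
  (rail     : ∀ {v} → v ∈ range b (m * 2) → suc v ∈ range b (m * 2) → Graph._~_ K v (suc v))
  (S : VertexSet) (tree : IsTree (K ∖ S)) where

  open Graph K

  ∈S-if : ∀ {v} → ¬ (v ∉ₛ S) → v ∈ₛ S
  ∈S-if {v} = decidable-stable (v ∈? elements S)

  triangle-hit : x ∉ₛ S → ∀ {v} → v ∈ range b (m * 2) → suc v ∈ range b (m * 2) →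
    v ∈ₛ S ⊎ suc v ∈ₛ S
  triangle-hit x∉S {v} v∈ sv∈ with v ∈? elements S
  ... | yes v∈S = inj₁ v∈S
  ... | no v∉S = inj₂ (∈S-if λ sv∉S →
    IsTree.acyclic tree x (v ∷ suc v ∷ []) record
      { distinct = (x≢ v∈ ∷ x≢ sv∈ ∷ []) ∷ (1+n≢n ∘ sym ∷ []) ∷ [] ∷ []
      ; long     = s≤s (s≤s z≤n)
      ; closed   = (spoke v∈ , x∉S , v∉S) ∷ (rail v∈ sv∈ , v∉S , sv∉S)
                   ∷ (~-sym (spoke sv∈) , sv∉S , x∉S) ∷ [-]
      })
    where
    x≢ : ∀ {w} → w ∈ range b (m * 2) → x ≢ w
    x≢ w∈ = <⇒≢ (<-≤-trans x<b (proj₁ (∈-range⁻ {b} {m * 2} w∈)))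

  -- One deleted vertex is picked from each of the first `j` triangles. The bound `b + j * 2` is
  -- where the next pair starts, which keeps the picks distinct.
  hits : x ∉ₛ S → ∀ j → j ≤ m →
    ∃[ vs ] length vs ≡ j × Unique vs × All (_∈ₛ S) vs × All (_< b + j * 2) vs
  hits x∉S zero _ = [] , refl , [] , [] , []
  hits x∉S (suc j) j<m with hits x∉S j (<⇒≤ j<m)
  ... | vs , refl , vs! , vs⊆S , vs< with triangle-hit x∉S v∈ sv∈
    where
    v<top = +-monoʳ-< b (m<n⇒m<1+n (n<1+n (j * 2)))
    sv<top = subst (_< b + suc j * 2) (+-suc b (j * 2)) (+-monoʳ-< b (n<1+n (suc (j * 2))))
    top≤ = +-monoʳ-≤ b (*-monoˡ-≤ 2 j<m)
    v∈ : b + j * 2 ∈ range b (m * 2)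
    v∈ = ∈-range⁺ (m≤m+n b _) (<-≤-trans v<top top≤)
    sv∈ : suc (b + j * 2) ∈ range b (m * 2)
    sv∈ = ∈-range⁺ (m≤n⇒m≤1+n (m≤m+n b _)) (<-≤-trans sv<top top≤)
  ... | inj₁ v∈S = _ ∷ vs , refl , All.map (λ w< → <⇒≢ w< ∘ sym) vs< ∷ vs! , v∈S ∷ vs⊆S ,
                   v<top ∷ All.map (λ w< → <-trans w< v<top) vs<
    where v<top = +-monoʳ-< b (m<n⇒m<1+n (n<1+n (j * 2)))
  ... | inj₂ sv∈S = _ ∷ vs , refl , All.map (λ w< → <⇒≢ (m<n⇒m<1+n w<) ∘ sym) vs< ∷ vs! ,
                    sv∈S ∷ vs⊆S ,
                    sv<top ∷ All.map (λ w< → <-trans (m<n⇒m<1+n w<) sv<top) vs<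
    where sv<top = subst (_< b + suc j * 2) (+-suc b (j * 2)) (+-monoʳ-< b (n<1+n (suc (j * 2))))

  bound : ∀ {k} → k ≤ m → k ≤ suc n → k ≤ ∣ S ∣ₛ
  bound k≤m k≤1+n with x ∈? elements S
  ... | no x∉S with hits x∉S m ≤-refl
  ...   | vs , refl , vs! , vs⊆S , _ = ≤-trans k≤m (Unique⇒length-≤ vs! (All.lookup vs⊆S))
  bound {k} k≤m k≤1+n | yes x∈S with All.all? (_∈? elements S) (range a n)
  ... | yes leaves⊆S = begin
    k                            ≤⟨ k≤1+n ⟩
    -- The additional one counts `x` itself.
    suc n                        ≡⟨ cong suc (length-applyUpTo (λ i → a + i) n) ⟨
    length (x ∷ range a n)       ≤⟨ Unique⇒length-≤ (∷-range-! n x<a)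
                                      (λ { (here refl) → x∈S ; (there v∈) → All.lookup leaves⊆S v∈ }) ⟩
    ∣ S ∣ₛ                       ∎
    where open ≤-Reasoning
  ... | no leaves⊈S with find (¬All⇒Any¬ (_∈? elements S) _ leaves⊈S)
  ...   | ℓ , ℓ∈ , ℓ∉S = begin
    k                            ≤⟨ k≤m ⟩
    m                            ≤⟨ m≤m*n m 2 ⟩
    m * 2                        ≡⟨ length-applyUpTo (λ i → b + i) (m * 2) ⟨
    length (range b (m * 2))     ≤⟨ Unique⇒length-≤ (range-! b (m * 2))
                                      (λ v∈ → ∈S-if (unreachable v∈)) ⟩
    ∣ S ∣ₛ                       ∎
    where
    open ≤-Reasoning
    unreachable : ∀ {v} → v ∈ range b (m * 2) → ¬ (v ∉ₛ S)
    unreachable v∈ v∉S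
      with IsTree.connected tree (∈-∖⁺ K S (leaf∈V ℓ∈) ℓ∉S) (∈-∖⁺ K S (path∈V v∈) v∉S)
    ... | ε                     = disjoint ℓ∈ v∈
    -- The first edge of a walk out of the surviving leaf must end in `x`, which is deleted.
    ... | (ℓ~w , _ , w∉S) ◅ _ with refl ← leaf~ ℓ∈ ℓ~w = w∉S x∈S

-- Paths and stars as trees

path⇒IsTree : ∀ K {b m} → (∀ {v} → v ∈ₛ Graph.V K → v ∈ range b (suc m)) →
  b ∈ₛ Graph.V K →
  (∀ {u v} → Graph._~_ K u v → Consecutive u v) →
  (∀ {u v} → u ∈ range b (suc m) → v ∈ range b (suc m) → suc v ≡ u → Graph._~_ K u v) →
  IsTree K
path⇒IsTree K {b} {m} V⊆ b∈V ~⇒ rail = unique-below⇒IsTree K below-≡ b b∈V below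
  where
  open Graph K
  predecessor : ∀ {u v} → u ~ v → v < u → suc v ≡ u
  predecessor u~v v<u with ~⇒ u~v
  ... | inj₁ refl = contradiction v<u (<-asym (n<1+n _))
  ... | inj₂ eq   = eq
  below-≡ : ∀ {u v w} → u ~ v → u ~ w → v < u → w < u → v ≡ w
  below-≡ u~v u~w v<u w<u =
    suc-injective (trans (predecessor u~v v<u) (sym (predecessor u~w w<u)))
  below : ∀ v → v ∈ₛ V → v ≡ b ⊎ (∃[ w ] v ~ w × w < v)
  below v v∈V with ∈-range⁻ {b} {suc m} (V⊆ v∈V)
  ... | b≤v , v< with m≤n⇒m<n∨m≡n b≤v
  ...   | inj₂ b≡v = inj₁ (sym b≡v)
  below (suc w) v∈V | b≤v , v< | inj₁ (s≤s b≤w) =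
    inj₂ (w , rail (V⊆ v∈V) (∈-range⁺ b≤w (<-trans (n<1+n w) v<)) refl , n<1+n w)

-- The centre is the root and has the smallest name, so it is the only possible parent.
star⇒IsTree : ∀ K x → x ∈ₛ Graph.V K →
  (∀ {v} → v ∈ₛ Graph.V K → v ≡ x ⊎ (Graph._~_ K v x × x < v)) →
  (∀ {u v} → Graph._~_ K u v → v < u → v ≡ x) →
  IsTree K
star⇒IsTree K x x∈V leaf below-is-x = unique-below⇒IsTree K
  (λ u~v u~w v<u w<u → trans (below-is-x u~v v<u) (sym (below-is-x u~w w<u)))
  x x∈V (λ v v∈V → Sum.map₂ (x ,_) (leaf v∈V))

-- Gluing at a single boundary vertex

module _ {x : Vertex} where

  gluable-fresh : ∀ {a} n (G H : Boundaried ⁅ x ⁆) → elements (Graph.V (graph H)) ≡ x ∷ range a n →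
    All (_< a) (elements (Graph.V (graph G))) → Gluable G H
  gluable-fresh {a} n _ _ VH≡ V<a {v} v∈G v∈H with subst (v ∈_) VH≡ v∈H
  ... | here v≡x = here v≡x , here v≡x
  ... | there v∈ = contradiction (proj₁ (∈-range⁻ {a} {n} v∈)) (<⇒≱ (All.lookup V<a v∈G))

  -- One test graph has to be gluable with both graphs, so its new names start above all names of
  -- either.
  fresh : ∀ (G G′ : Boundaried ⁅ x ⁆) → ∃[ b ] x < b ×
    All (_< b) (elements (Graph.V (graph G))) × All (_< b) (elements (Graph.V (graph G′)))
  fresh G G′ = suc (max 0 (vs ++ vs′)) ,
    All.lookup (++⁻ˡ vs below) (boundary⊆V G (here refl)) , ++⁻ˡ vs below , ++⁻ʳ vs below
    where
    vs  = elements (Graph.V (graph G))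
    vs′ = elements (Graph.V (graph G′))
    below = All.map s≤s (xs≤max 0 (vs ++ vs′))

  -- The star without leaves is neutral for gluing; it serves as the test graph that bounds the
  -- shift.
  point : Boundaried ⁅ x ⁆
  point = star x (n<1+n x) 0

  gluable-point : ∀ (G : Boundaried ⁅ x ⁆) → Gluable G point
  gluable-point _ _ (here refl) = here refl , here refl

  -- Gluing the point adds neither vertices nor edges; only the representation changes, and the tree
  -- properties are carried across.
  ⊕-point-IsTree : ∀ (G : Boundaried ⁅ x ⁆) S → IsTree (graph G ∖ S) → IsTree ((G ⊕ point) ∖ S)
  ⊕-point-IsTree G S tree = record
    { nonempty  = let v , v∈ = IsTree.nonempty tree
                      v∈G , v∉S = ∈-∖⁻ (graph G) S v∈
                  in v , ∈-∖⁺ (G ⊕ point) S (∈-∪⁺ˡ V ⁅ x ⁆ v∈G) v∉S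
    ; connected = λ u∈ v∈ → Star.map (λ (e , u∉S , v∉S) → inj₁ e , u∉S , v∉S)
                                     (IsTree.connected tree (V⊆ u∈) (V⊆ v∈))
    ; acyclic   = λ y ys cycle → IsTree.acyclic tree y ys record
        { distinct = IsCycle.distinct cycle
        ; long     = IsCycle.long cycle
        ; closed   = Linked.map old-edge (IsCycle.closed cycle)
        }
    }
    where
    open Graph (graph G)
    V⊆ : ∀ {v} → v ∈ₛ Graph.V ((G ⊕ point) ∖ S) → v ∈ₛ Graph.V (graph G ∖ S)
    V⊆ v∈ with ∈-∖⁻ (G ⊕ point) S v∈
    ... | v∈K , v∉S with ∈-∪⁻ V ⁅ x ⁆ v∈K
    ...   | inj₁ v∈V         = ∈-∖⁺ (graph G) S v∈V v∉S
    ...   | inj₂ (here refl) = ∈-∖⁺ (graph G) S (boundary⊆V G (here refl)) v∉S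
    old-edge : ∀ {u v} → Graph._~_ ((G ⊕ point) ∖ S) u v → Graph._~_ (graph G ∖ S) u v
    old-edge (inj₁ e , ∉S) = e , ∉S
    old-edge (inj₂ (inj₁ (_ , ())) , _)
    old-edge (inj₂ (inj₂ (inj₁ (_ , ()))) , _)
    old-edge (inj₂ (inj₂ (inj₂ (() , _))) , _)

  module _ {b : ℕ} (x<b : x < b) (G : Boundaried ⁅ x ⁆)
    (V<b : All (_< b) (elements (Graph.V (graph G)))) where

    open Graph (graph G)

    ∉V : ∀ {n v} → v ∈ range b n → v ∉ₛ V
    ∉V {n} v∈ v∈V = <⇒≱ (All.lookup V<b v∈V) (proj₁ (∈-range⁻ {b} {n} v∈))

    x∈V : x ∈ₛ V
    x∈V = boundary⊆V G (here refl)

    -- Deleting all of `G` takes `x` along and leaves the bare path, which `suc m` keeps nonempty.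
    feasible-⊕-fan : ∀ m → MinimizationProblem.Feasible TDS (G ⊕ fan x x<b (suc m)) V
    feasible-⊕-fan m = ∈-∪⁺ˡ V VF , path⇒IsTree (K ∖ V) V⊆ b∈ consecutive rail
      where
      F = fan x x<b (suc m)
      VF = Graph.V (graph F)
      K = G ⊕ F
      P = range b (suc m * 2)
      V⊆ : ∀ {v} → v ∈ₛ Graph.V (K ∖ V) → v ∈ P
      V⊆ v∈ with ∈-∖⁻ K V v∈
      ... | v∈K , v∉V with ∈-∪⁻ V VF v∈K
      ...   | inj₁ v∈V         = contradiction v∈V v∉V
      ...   | inj₂ (here refl) = contradiction x∈V v∉V
      ...   | inj₂ (there v∈P) = v∈P
      b∈ : b ∈ₛ Graph.V (K ∖ V)
      b∈ = ∈-∖⁺ K V (∈-∪⁺ʳ V VF (there b∈P)) (∉V b∈P)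
        where b∈P = ∈-range⁺ {b} {suc m * 2} ≤-refl (m<m+n b (s≤s z≤n))
      consecutive : ∀ {u v} → Graph._~_ (K ∖ V) u v → Consecutive u v
      consecutive (inj₁ u~v , u∉V , _)                     = contradiction (~-left u~v) u∉V
      consecutive (inj₂ (inj₁ (refl , _)) , u∉V , _)       = contradiction x∈V u∉V
      consecutive (inj₂ (inj₂ (inj₁ (refl , _))) , _ , v∉V) = contradiction x∈V v∉V
      consecutive (inj₂ (inj₂ (inj₂ (_ , _ , c))) , _)     = c
      rail : ∀ {u v} → u ∈ P → v ∈ P → suc v ≡ u → Graph._~_ (K ∖ V) u v
      rail u∈ v∈ eq = inj₂ (inj₂ (inj₂ (u∈ , v∈ , inj₂ eq))) , ∉V u∈ , ∉V v∈

    -- Here `x` is kept: it is the centre that holds the leaves together.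
    feasible-⊕-star : ∀ n →
      MinimizationProblem.Feasible TDS (G ⊕ star x x<b n) (Graph.V (graph G ∖ ⁅ x ⁆))
    feasible-⊕-star n = ∈-∪⁺ˡ V VF ∘ proj₁ ∘ ∈-∖⁻ (graph G) ⁅ x ⁆ ,
      star⇒IsTree (K ∖ S) x (∈-∖⁺ K S (∈-∪⁺ˡ V VF x∈V) x∉S) leaf below-is-x
      where
      F = star x x<b n
      VF = Graph.V (graph F)
      K = G ⊕ F
      S = Graph.V (graph G ∖ ⁅ x ⁆)
      x∉S : x ∉ₛ S
      x∉S x∈S = proj₂ (∈-∖⁻ (graph G) ⁅ x ⁆ x∈S) (here refl)
      ∉S⇒≡x : ∀ {v} → v ∈ₛ V → v ∉ₛ S → v ≡ x
      ∉S⇒≡x {v} v∈V v∉S = decidable-stable (v ≟ x) λ v≢x →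
        v∉S (∈-∖⁺ (graph G) ⁅ x ⁆ v∈V λ { (here v≡x) → v≢x v≡x })
      leaf : ∀ {v} → v ∈ₛ Graph.V (K ∖ S) → v ≡ x ⊎ (Graph._~_ (K ∖ S) v x × x < v)
      leaf v∈ with ∈-∖⁻ K S v∈
      ... | v∈K , v∉S with ∈-∪⁻ V VF v∈K
      ...   | inj₁ v∈V         = inj₁ (∉S⇒≡x v∈V v∉S)
      ...   | inj₂ (here v≡x)  = inj₁ v≡x
      ...   | inj₂ (there v∈L) = inj₂ ((inj₂ (inj₂ (inj₁ (refl , v∈L))) , v∉S , x∉S) ,
                                       <-≤-trans x<b (proj₁ (∈-range⁻ {b} {n} v∈L)))
      below-is-x : ∀ {u v} → Graph._~_ (K ∖ S) u v → v < u → v ≡ x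
      below-is-x (inj₁ u~v , _ , v∉S) _ = ∉S⇒≡x (~-left (~-sym u~v)) v∉S
      below-is-x (inj₂ (inj₁ (refl , v∈L)) , _) v<x =
        contradiction (<-≤-trans x<b (proj₁ (∈-range⁻ {b} {n} v∈L))) (<-asym v<x)
      below-is-x (inj₂ (inj₂ (inj₁ (v≡x , _))) , _) _ = v≡x
      below-is-x (inj₂ (inj₂ (inj₂ (_ , _ , ()))) , _)

-- The two families and the sizes of their representatives

module _ (x : Vertex) where

  -- With `suc m`, a fan minus its centre is never the empty graph, which is not a tree.
  stars fans : ℕ → Boundaried ⁅ x ⁆
  stars n = star x (n<1+n x) n
  fans m = fan x (n<1+n x) (suc m)

  star∖centre-edgeless : ∀ n → Edgeless (graph (stars n) ∖ ⁅ x ⁆)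
  star∖centre-edgeless n u v (inj₁ (u≡x , _) , u∉ , _)         = u∉ (here u≡x)
  star∖centre-edgeless n u v (inj₂ (inj₁ (v≡x , _)) , _ , v∉)  = v∉ (here v≡x)
  star∖centre-edgeless n u v (inj₂ (inj₂ (_ , _ , ())) , _)

  star∖∅-IsTree : ∀ n → IsTree (graph (stars n) ∖ ∅ₛ)
  star∖∅-IsTree n = star⇒IsTree (K ∖ ∅ₛ) x (∈-∖⁺ K ∅ₛ (here refl) λ ()) leaf below-is-x
    where
    K = graph (stars n)
    leaf : ∀ {v} → v ∈ₛ Graph.V (K ∖ ∅ₛ) → v ≡ x ⊎ (Graph._~_ (K ∖ ∅ₛ) v x × x < v)
    leaf v∈ with ∈-∖⁻ K ∅ₛ v∈
    ... | here v≡x  , _ = inj₁ v≡x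
    ... | there v∈L , _ = inj₂ ((inj₂ (inj₁ (refl , v∈L)) , (λ ()) , (λ ())) ,
                                proj₁ (∈-range⁻ {suc x} {n} v∈L))
    below-is-x : ∀ {u v} → Graph._~_ (K ∖ ∅ₛ) u v → v < u → v ≡ x
    below-is-x (inj₁ (refl , v∈L) , _) v<x =
      contradiction (proj₁ (∈-range⁻ {suc x} {n} v∈L)) (<-asym v<x)
    below-is-x (inj₂ (inj₁ (v≡x , _)) , _) _ = v≡x
    below-is-x (inj₂ (inj₂ (_ , _ , ())) , _)

  fan∖centre-IsTree : ∀ m → IsTree (graph (fans m) ∖ ⁅ x ⁆)
  fan∖centre-IsTree m = path⇒IsTree (F ∖ ⁅ x ⁆) V⊆ a∈ consecutive rail
    where
    F = graph (fans m)
    P = range (suc x) (suc m * 2)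
    V⊆ : ∀ {v} → v ∈ₛ Graph.V (F ∖ ⁅ x ⁆) → v ∈ P
    V⊆ v∈ with ∈-∖⁻ F ⁅ x ⁆ v∈
    ... | here v≡x , v∉  = contradiction (here v≡x) v∉
    ... | there v∈P , _  = v∈P
    ∉x : ∀ {v} → v ∈ P → v ∉ₛ ⁅ x ⁆
    ∉x v∈P (here refl) = <⇒≱ (n<1+n x) (proj₁ (∈-range⁻ {suc x} {suc m * 2} v∈P))
    a∈ : suc x ∈ₛ Graph.V (F ∖ ⁅ x ⁆)
    a∈ = ∈-∖⁺ F ⁅ x ⁆ (there a∈P) (∉x a∈P)
      where a∈P = ∈-range⁺ {suc x} {suc m * 2} ≤-refl (m<m+n (suc x) (s≤s z≤n))
    consecutive : ∀ {u v} → Graph._~_ (F ∖ ⁅ x ⁆) u v → Consecutive u v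
    consecutive (inj₁ (u≡x , _) , u∉ , _)        = contradiction (here u≡x) u∉
    consecutive (inj₂ (inj₁ (v≡x , _)) , _ , v∉) = contradiction (here v≡x) v∉
    consecutive (inj₂ (inj₂ (_ , _ , c)) , _)    = c
    rail : ∀ {u v} → u ∈ P → v ∈ P → suc v ≡ u → Graph._~_ (F ∖ ⁅ x ⁆) u v
    rail u∈ v∈ eq = inj₂ (inj₂ (u∈ , v∈ , inj₂ eq)) , ∉x u∈ , ∉x v∈

  module _ {b : ℕ} (x<b : x < b) (n : ℕ) (VG<b : All (_< b) (elements (Graph.V (graph (stars n))))) where
    private
      G = stars n
      VG = Graph.V (graph G)
      F = fan x x<b (suc n)
      VF = Graph.V (graph F)

      disjoint : ∀ {v} → v ∈ range (suc x) n → v ∉ range b (suc n * 2)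
      disjoint v∈ v∈F = ∉V x<b G VG<b {suc n * 2} v∈F (there v∈)

      leaf~ : ∀ {v w} → v ∈ range (suc x) n → Graph._~_ (G ⊕ F) v w → w ≡ x
      leaf~ v∈ (inj₁ (inj₁ (refl , _))) =
        contradiction (proj₁ (∈-range⁻ {suc x} {n} v∈)) (<⇒≱ (n<1+n x))
      leaf~ v∈ (inj₁ (inj₂ (inj₁ (w≡x , _)))) = w≡x
      leaf~ v∈ (inj₁ (inj₂ (inj₂ (_ , _ , ()))))
      leaf~ v∈ (inj₂ (inj₁ (refl , _))) =
        contradiction (proj₁ (∈-range⁻ {suc x} {n} v∈)) (<⇒≱ (n<1+n x))
      leaf~ v∈ (inj₂ (inj₂ (inj₁ (w≡x , _)))) = w≡x
      leaf~ v∈ (inj₂ (inj₂ (inj₂ (v∈F , _)))) = contradiction v∈F (disjoint v∈)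

    -- Keeping `x` costs one vertex for each of the `suc n` triangles; deleting it costs `x` and the
    -- `n` leaves, or else the whole path.
    star⊕fan-bound : ∀ S → MinimizationProblem.Feasible TDS (G ⊕ F) S → suc n ≤ ∣ S ∣ₛ
    star⊕fan-bound S (_ , tree) =
      TriangleBound.bound (G ⊕ F) x {n = n} {m = suc n} (n<1+n x) x<b disjoint
        (λ v∈ → ∈-∪⁺ˡ VG VF (there v∈)) leaf~
        (λ v∈ → ∈-∪⁺ʳ VG VF (there v∈))
        (λ v∈ → inj₂ (inj₁ (refl , v∈)))
        (λ v∈ sv∈ → inj₂ (inj₂ (inj₂ (v∈ , sv∈ , inj₁ refl))))
        S tree ≤-refl ≤-refl

    -- The star is a tree already, so the point shows that the shift is at most 0; in the fan test,
    -- `G′` can be deleted entirely.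
    star-equivalent-size : ∀ G′ → All (_< b) (elements (Graph.V (graph G′))) →
      ∀ {Δ} → EquivalentWithShift TDS G G′ Δ → suc n ≤ ∣ Graph.V (graph G′) ∣ₛ
    star-equivalent-size G′ VG′<b G≡G′ = subst (suc n ≤_) (+-identityʳ _)
      (equivalent⇒lower-bound TDS {G = G} {G′} G≡G′
        (point {x}) (gluable-point G) (gluable-point G′)
        ∅ₛ ((λ ()) , ⊕-point-IsTree G ∅ₛ (star∖∅-IsTree n))
        F (gluable-fresh (suc n * 2) G F refl VG<b) (gluable-fresh (suc n * 2) G′ F refl VG′<b)
        VG (feasible-⊕-fan x<b G VG<b n)
        star⊕fan-bound
        VG′ (feasible-⊕-fan x<b G′ VG′<b n))
      where
      VG′ = Graph.V (graph G′)

  stars-incompressible : Incompressible TDS ⁅ x ⁆ stars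
  stars-incompressible n G′ (_ , G≡G′) =
    let _ , x<b , VG<b , VG′<b = fresh (stars n) G′
    in <⇒≤ (star-equivalent-size x<b n VG<b G′ VG′<b G≡G′)

  module _ {b : ℕ} (x<b : x < b) (n : ℕ) (VG<b : All (_< b) (elements (Graph.V (graph (fans n))))) where
    private
      G = fans n
      VG = Graph.V (graph G)
      H = star x x<b (suc n)
      VH = Graph.V (graph H)

      disjoint : ∀ {v} → v ∈ range b (suc n) → v ∉ range (suc x) (suc n * 2)
      disjoint v∈ v∈G = ∉V x<b G VG<b {suc n} v∈ (there v∈G)

      leaf~ : ∀ {v w} → v ∈ range b (suc n) → Graph._~_ (G ⊕ H) v w → w ≡ x
      leaf~ v∈ (inj₁ v~w) =
        contradiction (Graph.~-left (graph G) v~w) (∉V x<b G VG<b {suc n} v∈)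
      leaf~ v∈ (inj₂ (inj₁ (refl , _))) =
        contradiction (proj₁ (∈-range⁻ {b} {suc n} v∈)) (<⇒≱ x<b)
      leaf~ v∈ (inj₂ (inj₂ (inj₁ (w≡x , _)))) = w≡x
      leaf~ v∈ (inj₂ (inj₂ (inj₂ (_ , _ , ()))))

    fan⊕star-bound : ∀ S → MinimizationProblem.Feasible TDS (G ⊕ H) S → suc n ≤ ∣ S ∣ₛ
    fan⊕star-bound S (_ , tree) =
      TriangleBound.bound (G ⊕ H) x {n = suc n} {m = suc n} x<b (n<1+n x) disjoint
        (λ v∈ → ∈-∪⁺ʳ VG VH (there v∈)) leaf~
        (λ v∈ → ∈-∪⁺ˡ VG VH (there v∈))
        (λ v∈ → inj₁ (inj₁ (refl , v∈)))
        (λ v∈ sv∈ → inj₁ (inj₂ (inj₂ (v∈ , sv∈ , inj₁ refl))))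
        -- The triangles give exactly `suc n`; `x` together with the `suc n` leaves would give one
        -- more.
        S tree ≤-refl (n≤1+n _)

    -- Deleting `x` turns a fan into a path, so the shift is at most 1. This one is cancelled
    -- against the bound `suc n`, which leaves `n`.
    fan-equivalent-size : ∀ G′ → All (_< b) (elements (Graph.V (graph G′))) →
      ∀ {Δ} → EquivalentWithShift TDS G G′ Δ → n ≤ ∣ Graph.V (graph G′) ∣ₛ
    fan-equivalent-size G′ VG′<b G≡G′ = ≤-trans
      (≤-pred (subst (suc n ≤_) (+-comm _ 1)
        (equivalent⇒lower-bound TDS {G = G} {G′} G≡G′
          (point {x}) (gluable-point G) (gluable-point G′)
          ⁅ x ⁆ ((λ { (here refl) → ∈-∪⁺ˡ VG ⁅ x ⁆ (here refl) }) ,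
                 ⊕-point-IsTree G ⁅ x ⁆ (fan∖centre-IsTree n))
          H (gluable-fresh (suc n) G H refl VG<b) (gluable-fresh (suc n) G′ H refl VG′<b)
          (Graph.V (graph G ∖ ⁅ x ⁆)) (feasible-⊕-star x<b G VG<b (suc n))
          fan⊕star-bound
          (Graph.V (graph G′ ∖ ⁅ x ⁆)) (feasible-⊕-star x<b G′ VG′<b (suc n)))))
      (length-filter _ (elements (Graph.V (graph G′))))

  fans-incompressible : Incompressible TDS ⁅ x ⁆ fans
  fans-incompressible n G′ (_ , G≡G′) =
    let _ , x<b , VG<b , VG′<b = fresh (fans n) G′
    in fan-equivalent-size x<b n VG<b G′ VG′<b G≡G′

  -- The centre alone covers all edges of a star, so the parameter is constantly 2: one for the
  -- boundary and one for the cover.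
  stars-no-kernelization : ∀ f → ¬ BoundariedKernelization f TDS VC
  stars-no-kernelization = incompressible⇒no-kernelization TDS stars stars-incompressible VC
    (λ _ → ⁅ x ⁆) (λ n → boundary⊆V (stars n) , star∖centre-edgeless n) (λ _ → refl)

  fan-centre-feasible : ∀ m → MinimizationProblem.Feasible TDS (graph (fans m)) ⁅ x ⁆
  fan-centre-feasible m = boundary⊆V (fans m) , fan∖centre-IsTree m

  fans-no-kernelization : ∀ f → ¬ BoundariedKernelization f TDS TDS
  fans-no-kernelization = incompressible⇒no-kernelization TDS fans fans-incompressible TDS
    (λ _ → ⁅ x ⁆) fan-centre-feasible (λ _ → refl)

mainTheorem12 : (∀ (f : ℕ → ℕ) → Computable f → ¬ BoundariedKernelization f TDS VC) ×
    (∀ (f : ℕ → ℕ) → Computable f → ¬ BoundariedKernelization f TDS TDS) ×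
    (∀ (x : Vertex) →
    InfinitelyManyClasses (GluingEquivalent TDS ⁅ x ⁆) (λ G → Edgeless (graph G ∖ ⁅ x ⁆)) ×
    InfinitelyManyClasses (GluingEquivalent TDS ⁅ x ⁆) (λ G → IsTree (graph G ∖ ⁅ x ⁆)))
mainTheorem12 =
    -- The name 0 for the boundary vertex is an arbitrary choice.
    (λ f _ → stars-no-kernelization 0 f)
  , (λ f _ → fans-no-kernelization 0 f)
  , (λ x → incompressible⇒infinitely-many TDS (stars x) (stars-incompressible x)
             (λ G → Edgeless (graph G ∖ ⁅ x ⁆)) (star∖centre-edgeless x)
         , incompressible⇒infinitely-many TDS (fans x) (fans-incompressible x)
             (λ G → IsTree (graph G ∖ ⁅ x ⁆)) (fan∖centre-IsTree x))
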